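{- For every type family $A:\mathrm{Tor}_{\mathbb Z}\to\mathcal U$, every $a:A(\mathrm{pt})$ and every path over the loop $p : a =^A_{\circlearrowleft} a$, there exist a dependent function $f:\prod_{Z:\mathrm{Tor}_{\mathbb Z}}A(Z)$, a path $r : f(\mathrm{pt}) = a$ in $A(\mathrm{pt})$, and an element of the type $$\mathrm{apd}_f(\circlearrowleft) =^{\tilde A}_{r} p,$$ where $\tilde A : A(\mathrm{pt})\to\mathcal U$ is the family $\tilde A(y) :\equiv (y =^A_{\circlearrowleft} y)$. In other words, the type $$\prod_{A:\mathrm{Tor}_{\mathbb Z}\to\mathcal U}\ \prod_{a:A(\mathrm{pt})}\ \prod_{p:a=^A_{\circlearrowleft}a}\ \sum_{f:\prod_{Z}A(Z)}\ \sum_{r:f(\mathrm{pt})=a}\ \big(\mathrm{apd}_f(\circlearrowleft)=^{\tilde A}_r p\big)$$ is inhabited.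
   Context: Work in homotopy type theory / univalent foundations with the univalence axiom and propositional truncation $\|{ - }\|$ (with constructor $|{ - }|$); no higher inductive types are assumed. $\mathbb Z$ is the set of integers with successor $s:\mathbb Z\to\mathbb Z$ (an equivalence). Define $\mathrm{Tor}_{\mathbb Z} :\equiv \sum_{X:\mathcal U}\sum_{f:X\to X}\|(\mathbb Z,s)=(X,f)\|$, where the identity type is taken in $\sum_{X:\mathcal U}(X\to X)$, and $\mathrm{pt} :\equiv (\mathbb Z,s,|\mathrm{refl}_{(\mathbb Z,s)}|)$. For a path $e:Z_1=Z_2$ in $\mathrm{Tor}_{\mathbb Z}$ with underlying types $X_1,X_2$, write $e_*:X_1\to X_2$ for transport along the induced path $X_1=X_2$ of underlying types. The loop $\circlearrowleft:\mathrm{pt}=\mathrm{pt}$ is the path obtained by univalence from the equivalence $s:\mathbb Z\simeq\mathbb Z$ (which commutes with $s$), the truncation component being a proposition; it satisfies $\circlearrowleft_*=s$. For $B:A\to\mathcal U$, $p:a_1=a_2$, $b_i:B(a_i)$, the type of paths over $p$ is $b_1=^B_p b_2 :\equiv (\mathrm{tr}^B(p,b_1)=b_2)$, where $\mathrm{tr}^B$ is transport; $\mathrm{apd}_f(p): f(a_1)=^B_p f(a_2)$ is the dependent action on paths of $f:\prod_x B(x)$. -}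

{-# OPTIONS --without-K --safe #-}

-- Everything is developed without K, so that univalence is a consistent
-- hypothesis.
module Defs where

open import Data.Integer.Base using (ℤ) renaming (suc to sucℤ; pred to predℤ)
open import Data.Integer.Properties using (suc-pred; pred-suc)
open import Data.Product using (Σ; Σ-syntax; _,_; proj₁; proj₂)
open import Function.Base using (_∘_; id)
open import Function.Bundles using (mk↔ₛ′)
open import Function.Properties.Inverse.HalfAdjointEquivalence using (_≃_; ↔⇒≃)
open import Level using (Level; Setω) renaming (suc to lsuc)
open import Relation.Binary.PropositionalEquality
  using (_≡_; refl; sym; trans; cong; subst)
open import Relation.Nullary using (Irrelevant)

private
  variable
    a b ℓ ℓ′ : Level

open _≃_ using (to)

IsEquiv : {A : Set a} {B : Set b} → (A → B) → Set _
IsEquiv {A = A} {B = B} f = Σ[ e ∈ A ≃ B ] to e ≡ f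

id≃ : {A : Set a} → A ≃ A
id≃ = record
  { to               = id
  ; from             = id
  ; left-inverse-of  = λ _ → refl
  ; right-inverse-of = λ _ → refl
  ; left-right       = λ _ → refl
  }

idToEquiv : {A B : Set ℓ} → A ≡ B → A ≃ B
idToEquiv refl = id≃

Univalence : (ℓ : Level) → Set (lsuc ℓ)
Univalence ℓ = {A B : Set ℓ} → IsEquiv (idToEquiv {A = A} {B = B})

UnivalenceAxiom : Setω
UnivalenceAxiom = ∀ ℓ → Univalence ℓ

-- The computation rule for `rec` on ∣_∣ holds up to ≡ because the target is a
-- proposition, and the dependent eliminator is derivable from `rec`.
record PropositionalTruncations : Setω where
  field
    ∥_∥    : Set ℓ → Set ℓ
    ∣_∣    : {A : Set ℓ} → A → ∥ A ∥
    squash : {A : Set ℓ} → Irrelevant ∥ A ∥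
    rec    : {A : Set ℓ} {P : Set ℓ′} → Irrelevant P → (A → P) → ∥ A ∥ → P

PathOver : {A : Set a} (B : A → Set b) {a₁ a₂ : A} →
           a₁ ≡ a₂ → B a₁ → B a₂ → Set b
PathOver B p b₁ b₂ = subst B p b₁ ≡ b₂

sucℤ≃ : ℤ ≃ ℤ
sucℤ≃ = ↔⇒≃ (mk↔ₛ′ sucℤ predℤ suc-pred pred-suc)

EndoPathOver : {X Y : Set ℓ} (p : X ≡ Y) {f : X → X} {g : Y → Y} →
               subst id p ∘ f ≡ g ∘ subst id p →
               PathOver (λ X → X → X) p f g
EndoPathOver refl eq = eq

module Torsors (univalence : UnivalenceAxiom)
               (truncations : PropositionalTruncations) where

  open PropositionalTruncations truncations

  ua : {A B : Set ℓ} → A ≃ B → A ≡ B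
  ua {ℓ = ℓ} = _≃_.from (proj₁ (univalence ℓ))

  idToEquiv-ua : {A B : Set ℓ} (e : A ≃ B) → idToEquiv (ua e) ≡ e
  idToEquiv-ua {ℓ = ℓ} e =
    trans (cong (λ h → h (ua e)) (sym (proj₂ (univalence ℓ))))
          (_≃_.right-inverse-of (proj₁ (univalence ℓ)) e)

  subst-ua : {A B : Set ℓ} (e : A ≃ B) → subst id (ua e) ≡ to e
  subst-ua e = trans (subst≡idToEquiv (ua e)) (cong to (idToEquiv-ua e))
    where
    subst≡idToEquiv : {A B : Set ℓ} (p : A ≡ B) → subst id p ≡ to (idToEquiv p)
    subst≡idToEquiv refl = refl

  Torℤ : Set₁
  Torℤ = Σ[ X ∈ Set ] Σ[ f ∈ (X → X) ]
           ∥ _≡_ {A = Σ[ X ∈ Set ] (X → X)} (ℤ , sucℤ) (X , f) ∥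

  pt : Torℤ
  pt = ℤ , sucℤ , ∣ refl ∣

  _₊ : {Z₁ Z₂ : Torℤ} → Z₁ ≡ Z₂ → proj₁ Z₁ → proj₁ Z₂
  e ₊ = subst id (cong proj₁ e)

  Torℤ-≡ : {Z₁ Z₂ : Torℤ} (p : proj₁ Z₁ ≡ proj₁ Z₂) →
           PathOver (λ X → X → X) p (proj₁ (proj₂ Z₁)) (proj₁ (proj₂ Z₂)) →
           Z₁ ≡ Z₂
  Torℤ-≡ {X , f , t₁} {_ , _ , t₂} refl refl =
    cong (λ t → X , f , t) (squash t₁ t₂)

  ↺ : pt ≡ pt
  ↺ = Torℤ-≡ (ua sucℤ≃) (EndoPathOver (ua sucℤ≃) commutes)
    where
    commutes : subst id (ua sucℤ≃) ∘ sucℤ ≡ sucℤ ∘ subst id (ua sucℤ≃)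
    commutes = subst (λ h → h ∘ sucℤ ≡ sucℤ ∘ h) (sym (subst-ua sucℤ≃)) refl

  ↺₊ : ↺ ₊ ≡ sucℤ
  ↺₊ = trans (cong (subst id) (proj₁-Torℤ-≡ _ _)) (subst-ua sucℤ≃)
    where
    proj₁-cong : {X : Set} {f : X → X} {t₁ t₂ : ∥ (ℤ , sucℤ) ≡ (X , f) ∥}
                 (q : t₁ ≡ t₂) →
                 cong {B = Set} proj₁ (cong {B = Torℤ} (λ t → X , f , t) q) ≡ refl
    proj₁-cong refl = refl

    proj₁-Torℤ-≡ : {Z₁ Z₂ : Torℤ} (p : proj₁ Z₁ ≡ proj₁ Z₂)
                   (q : PathOver (λ X → X → X) p
                          (proj₁ (proj₂ Z₁)) (proj₁ (proj₂ Z₂))) →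
                   cong proj₁ (Torℤ-≡ {Z₁} {Z₂} p q) ≡ p
    proj₁-Torℤ-≡ {_ , _ , t₁} {_ , _ , t₂} refl refl = proj₁-cong (squash t₁ t₂)

{-# OPTIONS --without-K #-}

-- The loop ↺ acts on the paths pt ≡ Z by precomposition, and since
-- Σ Torℤ proj₁ is contractible, (pt ≡ pt , trans ↺) is a copy of (ℤ , sucℤ).
-- Hence the type of triples consisting of y : A Z, paths over e from a to y for
-- all e : pt ≡ Z, and a proof that these commute with (↺ , p), is contractible
-- when Z is pt: by the universal property of ℤ it amounts to one y with one path
-- over one fixed loop.  As being contractible is a proposition and Torℤ is
-- connected, it is contractible for every Z; the first components of the centres
-- form f.
module Submission where

open import Axiom.UniquenessOfIdentityProofs using (module Decidable⇒UIP)
open import Data.Integer.Base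
  using (ℤ; +_; -[1+_]; 0ℤ; 1ℤ; _+_; -_) renaming (suc to sucℤ; pred to predℤ)
open import Data.Integer.Properties
  using (_≟_; +-assoc; +-identityˡ; +-identityʳ; +-inverseˡ; +-inverseʳ; pred-suc)
open import Data.Nat.Base using (zero; suc)
open import Data.Product using (Σ; Σ-syntax; _×_; _,_; proj₁; proj₂)
open import Function.Base using (_∘_; id)
open import Function.Bundles using (mk↔ₛ′)
open import Function.Definitions using (StrictlySurjective)
open import Function.Properties.Inverse.HalfAdjointEquivalence using (_≃_; ↔⇒≃)
open import Level using (Level; Lift; lift; lower; 0ℓ; _⊔_) renaming (suc to lsuc)
open import Relation.Binary.PropositionalEquality
  using (_≡_; refl; sym; trans; cong; cong₂; cong-app; subst; dcong;
         trans-reflʳ; trans-symˡ; cong-id; subst-subst)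
open import Relation.Nullary using (Irrelevant)
open import Defs

private
  variable
    a b d ℓ q : Level

open _≃_ using (to)

-- Contractibility.

IsContr : Set a → Set a
IsContr A = Σ[ c ∈ A ] (∀ x → c ≡ x)

HasContrFibres : {A : Set a} {B : Set b} → (A → B) → Set (a ⊔ b)
HasContrFibres f = ∀ y → IsContr (Σ[ x ∈ _ ] f x ≡ y)

isContr⇒irrelevant : {A : Set a} → IsContr A → Irrelevant A
isContr⇒irrelevant (c , p) x y = trans (sym (p x)) (p y)

isContr⇒≡-isContr : {A : Set a} → IsContr A → (x y : A) → IsContr (x ≡ y)
isContr⇒≡-isContr {A = A} (c , p) x y = trans (sym (p x)) (p y) , unique
  where
  unique : {y : A} (r : x ≡ y) → trans (sym (p x)) (p y) ≡ r
  unique refl = trans-symˡ (p x)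

singleton-isContr : {A : Set a} (x : A) → IsContr (Σ[ y ∈ A ] x ≡ y)
singleton-isContr x = (x , refl) , λ { (_ , refl) → refl }

contrFibres⇒≃ : {A : Set a} {B : Set b} (f : A → B) → HasContrFibres f → A ≃ B
contrFibres⇒≃ f c = ↔⇒≃ (mk↔ₛ′ f (λ y → proj₁ (proj₁ (c y)))
  (λ y → proj₂ (proj₁ (c y)))
  (λ x → cong proj₁ (proj₂ (c (f x)) (x , refl))))

-- Integer arithmetic.

ℤ-irrelevant : {i j : ℤ} → Irrelevant (i ≡ j)
ℤ-irrelevant = Decidable⇒UIP.≡-irrelevant _≟_

sucℤ-injective : ∀ {i j} → sucℤ i ≡ sucℤ j → i ≡ j
sucℤ-injective {i} {j} eq = trans (sym (pred-suc i)) (trans (cong predℤ eq) (pred-suc j))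

+-cancel : ∀ i j → (i + j) + - j ≡ i
+-cancel i j = trans (+-assoc i j (- j))
                     (trans (cong (λ k → i + k) (+-inverseʳ j)) (+-identityʳ i))

+-cancel′ : ∀ i j → (i + - j) + j ≡ i
+-cancel′ i j = trans (+-assoc i (- j) j)
                      (trans (cong (λ k → i + k) (+-inverseˡ j)) (+-identityʳ i))

+-contrFibres : ∀ x → HasContrFibres (_+ x)
+-contrFibres x y = (y + - x , +-cancel′ y x) ,
  λ (n , r) → fibre-≡ (trans (cong (λ k → k + - x) (sym r)) (+-cancel n x))
  where
  fibre-≡ : ∀ {m n} {r : m + x ≡ y} {s : n + x ≡ y} → m ≡ n →
            _≡_ {A = Σ[ k ∈ ℤ ] k + x ≡ y} (m , r) (n , s)
  fibre-≡ {m} {r = r} {s} refl = cong (m ,_) (ℤ-irrelevant r s)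

-- Equivariant sections and the universal property of `ℤ`.

Section : (D : Set d) (σ : D → D) (P : D → Set ℓ) → (∀ x → P x → P (σ x)) → Set (d ⊔ ℓ)
Section D σ P τ = Σ[ h ∈ (∀ x → P x) ] (∀ x → h (σ x) ≡ τ x (h x))

-- Split surjectivity of τ suffices here, and unlike invertibility it is easily
-- transferred to the identity types h x ≡ h′ x that arise in section-≡.
HasSections : (ℓ : Level) (D : Set d) → (D → D) → D → Set (d ⊔ lsuc ℓ)
HasSections ℓ D σ d₀ =
  (P : D → Set ℓ) (τ : ∀ x → P x → P (σ x)) →
  (∀ x → StrictlySurjective _≡_ (τ x)) → P d₀ → Section D σ P τ

-- The value at `0ℤ` is carried upwards by `τ` and downwards by chosen preimages under `τ`.
ℤ-sections : HasSections ℓ ℤ sucℤ 0ℤ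
ℤ-sections P τ s p₀ = h , compatible
  where
  h : ∀ n → P n
  h (+ zero)       = p₀
  h (+ suc n)      = τ (+ n) (h (+ n))
  h -[1+ zero ]    = proj₁ (s -[1+ zero ] p₀)
  h -[1+ suc n ]   = proj₁ (s -[1+ suc n ] (h -[1+ n ]))

  compatible : ∀ n → h (sucℤ n) ≡ τ n (h n)
  compatible (+ n)        = refl
  compatible -[1+ zero ]  = sym (proj₂ (s -[1+ zero ] p₀))
  compatible -[1+ suc n ] = sym (proj₂ (s -[1+ suc n ] (h -[1+ n ])))

-- Equivariance carries the equation upwards, injectivity of the successor downwards. This rigidity
-- makes charts unique.
sucℤ-equivariant⇒+ : (φ : ℤ → ℤ) → (∀ n → φ (sucℤ n) ≡ sucℤ (φ n)) →
                     ∀ n → n + φ 0ℤ ≡ φ n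
sucℤ-equivariant⇒+ φ e = proj₁ (ℤ-sections (λ n → n + φ 0ℤ ≡ φ n) step
  (λ n r → sucℤ-injective (trans (sym (+-assoc 1ℤ n (φ 0ℤ))) (trans r (e n))) ,
           ℤ-irrelevant _ _)
  (+-identityˡ (φ 0ℤ)))
  where
  step : ∀ n → n + φ 0ℤ ≡ φ n → sucℤ n + φ 0ℤ ≡ φ (sucℤ n)
  step n r = trans (+-assoc 1ℤ n (φ 0ℤ)) (trans (cong sucℤ r) (sym (e n)))

-- Concatenation and paths over paths.

trans-strictlySurjective : {A : Set a} {x y z : A} (r : x ≡ y) →
                           StrictlySurjective _≡_ (trans {k = z} r)
trans-strictlySurjective refl s = s , refl

cong-trans-strictlySurjective : {A : Set a} {x y z : A} (r : x ≡ y) {s t : y ≡ z} →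
                                StrictlySurjective _≡_ (cong (trans r) {s} {t})
cong-trans-strictlySurjective refl u = u , cong-id u

-- Following it by a path over `e` concatenates `p` with that path, over `trans l e`; this is how
-- the loop acts on cones.
prepend : {I : Set d} (A : I → Set ℓ) {i j k : I} (l : i ≡ j) {x : A i} {y : A j} →
          PathOver A l x y → (e : j ≡ k) → subst A (trans l e) x ≡ subst A e y
prepend A l p e = trans (sym (subst-subst l)) (cong (subst A e) p)

-- `trans l refl` is not `l` by definition; letting `h` range over all `e` allows induction on `l`.
prepend-refl : {I : Set d} (A : I → Set ℓ) {i j : I} (l : i ≡ j)
               {x : A i} {y z : A j} (p : PathOver A l x y)
               (h : (e : i ≡ j) → PathOver A e x z) {s : y ≡ z} →
               h (trans l refl) ≡ trans (prepend A l p refl) s → h l ≡ trans p s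
prepend-refl A refl p h {s} eq = trans eq (cong (λ r → trans r s) (cong-id p))

section-dcong : {I : Set d} (A : I → Set ℓ) {i : I} {x : A i} (f : ∀ j → A j)
                (h : ∀ j (e : i ≡ j) → PathOver A e x (f j)) {j : I} (e : i ≡ j) →
                h j e ≡ trans (cong (subst A e) (h i refl)) (dcong f e)
section-dcong A {i} f h refl = sym (trans (trans-reflʳ _) (cong-id (h i refl)))

-- The hypothesis is a commuting square. The inverse of `s` appears because cones supply paths from
-- `x` to the value of `f`.
pathOver-loop : {I : Set d} (A : I → Set ℓ) {i : I} (l : i ≡ i) {x y : A i}
                (s : x ≡ y) {u : PathOver A l y y} {p : PathOver A l x x} →
                trans (cong (subst A l) s) u ≡ trans p s →
                PathOver (λ z → PathOver A l z z) (sym s) u p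
pathOver-loop A l refl {p = p} eq = trans eq (trans-reflʳ p)

module _ (univalence : UnivalenceAxiom) (truncations : PropositionalTruncations) where
  open Torsors univalence truncations
  open PropositionalTruncations truncations

  -- Equivalence induction and function extensionality.

  ≃-induction : {A : Set a} (Q : (B : Set a) → (A → B) → Set q) → Q A id →
                {B : Set a} (e : A ≃ B) → Q B (to e)
  ≃-induction {A = A} Q base e =
    subst (λ e → Q _ (to e)) (idToEquiv-ua e) (along (ua e))
    where
    along : {B : Set _} (r : A ≡ B) → Q B (to (idToEquiv r))
    along refl = base

  ∘-fibre-irrelevant : {I : Set b} {A B : Set a} (e : A ≃ B) (g : I → B) →
                       Irrelevant (Σ[ u ∈ (I → A) ] to e ∘ u ≡ g)
  ∘-fibre-irrelevant {I = I} {A = A} = ≃-induction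
    (λ B φ → (g : I → B) → Irrelevant (Σ[ u ∈ (I → A) ] φ ∘ u ≡ g))
    (λ { _ (_ , refl) (_ , refl) → refl })

  -- The sections of B are a retract of the fibre over the identity of
  -- composition with the equivalence proj₁ : Σ A B → A.
  Π-isContr⇒irrelevant : {A : Set a} {B : A → Set b} → (∀ x → IsContr (B x)) →
                         Irrelevant (∀ x → B x)
  Π-isContr⇒irrelevant {b = b} {A = A} {B} c f g = cong
    (λ (u , r) x → subst B (cong lower (cong-app r x)) (proj₂ (u x)))
    (∘-fibre-irrelevant proj₁≃ lift ((λ x → x , f x) , refl) ((λ x → x , g x) , refl))
    where
    proj₁≃ : Σ A B ≃ Lift b A
    proj₁≃ = ↔⇒≃ (mk↔ₛ′ (lift ∘ proj₁) (λ (lift x) → x , proj₁ (c x))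
      (λ _ → refl) (λ (x , y) → cong (x ,_) (proj₂ (c x) y)))

  -- The pairs of `g` and `k` are sections of a family of singletons, and these form a proposition.
  homotopy-induction : {A : Set a} {B : A → Set b} {f : ∀ x → B x}
                       (Q : (g : ∀ x → B x) → (∀ x → f x ≡ g x) → Set q) →
                       Q f (λ _ → refl) → ∀ {g} (k : ∀ x → f x ≡ g x) → Q g k
  homotopy-induction {f = f} Q base {g} k = subst
    (λ u → Q (proj₁ ∘ u) (proj₂ ∘ u))
    (Π-isContr⇒irrelevant (λ x → singleton-isContr (f x))
      (λ x → f x , refl) (λ x → g x , k x))
    base

  funext : {A : Set a} {B : A → Set b} {f g : ∀ x → B x} →
           (∀ x → f x ≡ g x) → f ≡ g
  funext {f = f} = homotopy-induction (λ g _ → f ≡ g) refl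

  isContr-irrelevant : {A : Set a} → Irrelevant (IsContr A)
  isContr-irrelevant {A = A} (c , p) (c′ , p′) = along (p c′) p′
    where
    along : ∀ {c′} → c ≡ c′ → (p′ : ∀ x → c′ ≡ x) → (c , p) ≡ (c′ , p′)
    along refl p′ =
      cong (c ,_) (Π-isContr⇒irrelevant (isContr⇒≡-isContr (c , p) c) p p′)

  -- A compatible homotopy is itself a section, of the identity types `h x ≡ h′ x`, so the existence
  -- principle also yields uniqueness.
  section-≡ : {D : Set d} {σ : D → D} {d₀ : D} → HasSections ℓ D σ d₀ →
              {P : D → Set ℓ} {τ : ∀ x → P x → P (σ x)} →
              (∀ x {y z} → StrictlySurjective _≡_ (cong (τ x) {y} {z})) →
              (u v : Section D σ P τ) → proj₁ u d₀ ≡ proj₁ v d₀ → u ≡ v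
  section-≡ {D = D} {σ} sections {P} {τ} surj (h , c) (h′ , c′) r₀ =
    homotopy-induction
      (λ h′ k → (c′ : ∀ x → h′ (σ x) ≡ τ x (h′ x)) →
                (∀ x → k (σ x) ≡ step c′ (k x)) → (h , c) ≡ (h′ , c′))
      (λ c′ kc → cong (h ,_) (funext (λ x → untwist (c x) (c′ x) (kc x))))
      (proj₁ homotopy) c′ (proj₂ homotopy)
    where
    step : ∀ {h′ : ∀ x → P x} (c′ : ∀ x → h′ (σ x) ≡ τ x (h′ x)) {x} →
           h x ≡ h′ x → h (σ x) ≡ h′ (σ x)
    step c′ {x} r = trans (c x) (trans (cong (τ x) r) (sym (c′ x)))

    cancel : {A : Set ℓ} {w x y z : A} (s : w ≡ x) (r : w ≡ y) (t : y ≡ z) →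
             trans s (trans (trans (sym s) (trans r t)) (sym t)) ≡ r
    cancel refl refl refl = refl

    untwist : {A : Set ℓ} {x y : A} (s t : x ≡ y) → refl ≡ trans s (sym t) → s ≡ t
    untwist s refl eq = trans (sym (trans-reflʳ s)) (sym eq)

    homotopy : Section D σ (λ x → h x ≡ h′ x) (λ _ → step c′)
    homotopy = sections _ (λ _ → step c′)
      -- Conjugating `r` by `c` and `c′` gives a path between values of `τ x`, which `surj` lifts.
      (λ x r → let s , eq = surj x (trans (sym (c x)) (trans r (c′ x))) in
        s , trans (cong (λ s → trans (c x) (trans s (sym (c′ x)))) eq)
                  (cancel (c x) r (c′ x)))
      r₀

  -- Induction on a loop in a connected type.

  module LoopInduction
    {I : Set d} {i : I} (connected : ∀ j → ∥ i ≡ j ∥)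
    (l : i ≡ i) {d₀ : i ≡ i} (sections : HasSections ℓ (i ≡ i) (trans l) d₀)
    (A : I → Set ℓ) (x : A i) (p : PathOver A l x x)
    where

    Cone : (j : I) → A j → Set _
    Cone j y = Section (i ≡ j) (trans l) (λ e → PathOver A e x y)
                       (λ e → trans (prepend A l p e))

    -- The component at `d₀` is a path from `subst A d₀ x` to `y`, so contracting a singleton fixes
    -- both; `section-≡` does the rest.
    cone-isContr-base : IsContr (Σ (A i) (Cone i))
    cone-isContr-base = (_ , apex) , λ (y , u) → subst
      (λ (y , r) → (u : Cone i y) → r ≡ proj₁ u d₀ → (_ , apex) ≡ (y , u))
      (isContr⇒irrelevant (singleton-isContr (subst A d₀ x))
        (_ , proj₁ apex d₀) (y , proj₁ u d₀))
      (λ u r → cong (_ ,_) (section-≡ sections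
        (λ e → cong-trans-strictlySurjective (prepend A l p e)) apex u r))
      u refl
      where
      apex : Cone i (subst A d₀ x)
      apex = sections _ _ (λ e → trans-strictlySurjective (prepend A l p e)) refl

    cone-isContr : ∀ j → IsContr (Σ (A j) (Cone j))
    cone-isContr j =
      rec isContr-irrelevant (λ { refl → cone-isContr-base }) (connected j)

    loop-induction : Σ[ f ∈ ((j : I) → A j) ] Σ[ r ∈ f i ≡ x ]
                     PathOver (λ y → PathOver A l y y) r (dcong f l) p
    loop-induction = f , sym (h i refl) , pathOver-loop A l (h i refl)
      -- Naturality makes `h i l` equal to `h i refl` followed by `dcong f l`; compatibility of the
      -- cone at `refl` makes it `p` followed by `h i refl`.
      (trans (sym (section-dcong A f h l))
             (prepend-refl A l p (h i) (proj₂ (proj₂ (proj₁ (cone-isContr i))) refl)))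
      where
      f : (j : I) → A j
      f j = proj₁ (proj₁ (cone-isContr j))

      h : ∀ j (e : i ≡ j) → PathOver A e x (f j)
      h j = proj₁ (proj₂ (proj₁ (cone-isContr j)))

  -- Charts of torsors and loops at `pt`.

  Chart : (X : Set) → (X → X) → X → Set
  Chart X f x = Σ[ φ ∈ (ℤ → X) ]
    (φ 0ℤ ≡ x) × (∀ n → φ (sucℤ n) ≡ f (φ n)) × HasContrFibres φ

  -- Contractibility is a proposition, so the torsor may be taken to be `ℤ`, where translation by
  -- `x` is the only chart. Contractible fibres state invertibility as a proposition.
  chart-isContr : (Z : Torℤ) (x : proj₁ Z) → IsContr (Chart _ (proj₁ (proj₂ Z)) x)
  chart-isContr (X , f , t) = rec
    (λ u v → funext (λ _ → isContr-irrelevant _ _)) along t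
    where
    ℤ-chart : ∀ x → Chart ℤ sucℤ x
    ℤ-chart x = _+ x , +-identityˡ x , (λ n → +-assoc 1ℤ n x) , +-contrFibres x

    unique : ∀ x (u : Chart ℤ sucℤ x) → ℤ-chart x ≡ u
    unique _ (φ , refl , e , c) = homotopy-induction
      (λ φ′ _ → ∀ {z e c} → ℤ-chart (φ 0ℤ) ≡ (φ′ , z , e , c))
      (cong (_ ,_) (cong₂ _,_ (ℤ-irrelevant _ _)
        (cong₂ _,_ (funext (λ _ → ℤ-irrelevant _ _))
                   (funext (λ _ → isContr-irrelevant _ _)))))
      (sucℤ-equivariant⇒+ φ e)

    along : ∀ {X f} → _≡_ {A = Σ[ X ∈ Set ] (X → X)} (ℤ , sucℤ) (X , f) →
            ∀ x → IsContr (Chart X f x)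
    along refl x = ℤ-chart x , unique x

  -- Opaque because the conversion check in decode-encode would unfold these paths.
  opaque
    pointed-torsor-≡ : (Z : Torℤ) (x : proj₁ Z) →
                       _≡_ {A = Σ Torℤ proj₁} (pt , 0ℤ) (Z , x)
    pointed-torsor-≡ Z@(X , f , t) x =
      let φ , φ0≡x , e , c = proj₁ (chart-isContr Z x) in
      -- Once `φ` is the identity, `x` becomes `0ℤ` and `f` becomes `sucℤ` by `funext`.
      ≃-induction
        (λ X φ → ∀ f t x → φ 0ℤ ≡ x → (∀ n → φ (sucℤ n) ≡ f (φ n)) →
                 _≡_ {A = Σ Torℤ proj₁} (pt , 0ℤ) ((X , f , t) , x))
        (λ { f t _ refl e → along (funext e) })
        (contrFibres⇒≃ φ c) f t x φ0≡x e
      where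
      along : ∀ {f t} → sucℤ ≡ f → _≡_ {A = Σ Torℤ proj₁} (pt , 0ℤ) ((ℤ , f , t) , 0ℤ)
      along refl = cong (λ t → (ℤ , sucℤ , t) , 0ℤ) (squash _ _)

  encode : {Z : Torℤ} → pt ≡ Z → proj₁ Z
  encode e = (e ₊) 0ℤ

  -- The leading inverse path makes `decode pt 0ℤ` equal to `refl`, as `decode-encode` requires.
  decode : (Z : Torℤ) → proj₁ Z → pt ≡ Z
  decode Z x = cong proj₁ (trans (sym (pointed-torsor-≡ pt 0ℤ)) (pointed-torsor-≡ Z x))

  encode-decode : ∀ Z x → encode (decode Z x) ≡ x
  encode-decode Z x = along (trans (sym (pointed-torsor-≡ pt 0ℤ)) (pointed-torsor-≡ Z x))
    where
    along : ∀ {u : Σ Torℤ proj₁} (r : (pt , 0ℤ) ≡ u) → encode (cong proj₁ r) ≡ proj₂ u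
    along refl = refl

  decode-encode : ∀ {Z} (e : pt ≡ Z) → decode Z (encode e) ≡ e
  decode-encode refl = cong (cong proj₁) (trans-symˡ (pointed-torsor-≡ pt 0ℤ))

  encode-↺ : ∀ {Z} (e : pt ≡ Z) → encode (trans ↺ e) ≡ proj₁ (proj₂ Z) (encode e)
  encode-↺ refl = trans (cong encode (trans-reflʳ ↺)) (cong-app ↺₊ 0ℤ)

  decode-sucℤ : ∀ n → decode pt (sucℤ n) ≡ trans ↺ (decode pt n)
  decode-sucℤ n = trans
    (cong (decode pt)
      (sym (trans (encode-↺ (decode pt n)) (cong sucℤ (encode-decode pt n)))))
    (decode-encode (trans ↺ (decode pt n)))

  -- Equivalence induction works within one universe, hence the `Lift`.
  decode≃ : Lift (lsuc 0ℓ) ℤ ≃ (pt ≡ pt)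
  decode≃ = ↔⇒≃ (mk↔ₛ′ (decode pt ∘ lower) (lift ∘ encode)
    decode-encode (λ (lift n) → cong lift (encode-decode pt n)))

  loop-sections : HasSections ℓ (pt ≡ pt) (trans ↺) (decode pt 0ℤ)
  loop-sections {ℓ = ℓ} = ≃-induction
    -- `σ` stays general: after the induction it agrees with the lifted successor only pointwise,
    -- and `funext` closes the gap.
    (λ D φ → (σ : D → D) → (∀ n → φ (lift (sucℤ n)) ≡ σ (φ (lift n))) →
             HasSections ℓ D σ (φ (lift 0ℤ)))
    (λ σ e → subst (λ σ → HasSections ℓ _ σ (lift 0ℤ)) (funext (e ∘ lower)) lifted)
    decode≃ (trans ↺) decode-sucℤ
    where
    lifted : HasSections ℓ (Lift (lsuc 0ℓ) ℤ) (lift ∘ sucℤ ∘ lower) (lift 0ℤ)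
    lifted P τ s p₀ =
      let h , c = ℤ-sections (P ∘ lift) (τ ∘ lift) (s ∘ lift) p₀ in h ∘ lower , c ∘ lower

  pt-connected : (Z : Torℤ) → ∥ pt ≡ Z ∥
  pt-connected (X , f , t) = rec squash (λ r → ∣ along r ∣) t
    where
    along : ∀ {X f t} → _≡_ {A = Σ[ X ∈ Set ] (X → X)} (ℤ , sucℤ) (X , f) →
            pt ≡ (X , f , t)
    along refl = cong (λ t → ℤ , sucℤ , t) (squash _ _)

mainTheorem1 : (univalence : UnivalenceAxiom) (truncations : PropositionalTruncations) →
    let open Torsors univalence truncations in
    {ℓ : Level} (A : Torℤ → Set ℓ) (a : A pt) (p : PathOver A ↺ a a) →
    Σ[ f ∈ ((Z : Torℤ) → A Z) ]
    Σ[ r ∈ f pt ≡ a ]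
    PathOver (λ y → PathOver A ↺ y y) r (dcong f ↺) p
mainTheorem1 univalence truncations A a p =
  LoopInduction.loop-induction univalence truncations
    (pt-connected univalence truncations) ↺ (loop-sections univalence truncations) A a p
  where open Torsors univalence truncations
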